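{- Let $G$ be a cycle. Then there are no evasive walks on $G$.
   Context: A walk on $G$ is an infinite sequence $R(1),R(2),\ldots$ of vertices with $R(i)$ adjacent to $R(i+1)$ for all $i$. A random walk on $G$: $R(1)$ uniform among vertices, each $R(i+1)$ uniform among neighbours of $R(i)$. For walks $R,S$, tokens $T_R,T_S$ start at $R(1),S(1)$; a move advances exactly one token one step along its own walk. The pair $(R,S)$ is successful if there is an infinite sequence of moves in which each token is advanced infinitely often and the tokens never occupy the same vertex simultaneously (including initially). A walk $S$ is evasive if for a random walk $R$ on $G$, $(R,S)$ is successful with positive probability. -}

module Defs where

open import Data.Nat as ℕ using (ℕ; zero; suc; NonZero; _%_)
open import Data.Nat.Properties using (_≟_)
open import Data.Fin using (Fin; toℕ)
open import Data.Bool using (Bool; true; false; if_then_else_)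
open import Data.List using (List; []; _∷_)
open import Data.Integer using (+_)
open import Data.Rational using (ℚ; _/_; _+_; _*_; _≤_; 0ℚ; 1ℚ; ½)
open import Data.Product using (Σ; ∃; _×_; _,_)
open import Data.Sum using (_⊎_)
open import Data.Unit using (⊤)
open import Relation.Nullary using (¬_; does)
open import Relation.Nullary.Decidable using (_⊎-dec_)
open import Relation.Binary.PropositionalEquality using (_≡_)

-- The cycle C_n on vertex set Fin n (intended for n ≥ 3):
-- i ~ j iff j = i+1 (mod n) or i = j+1 (mod n).
module Cycle (n : ℕ) .{{_ : NonZero n}} where

  Adj : Fin n → Fin n → Set
  Adj i j = (toℕ j ≡ (suc (toℕ i)) % n) ⊎ (toℕ i ≡ (suc (toℕ j)) % n)

  adj? : Fin n → Fin n → Bool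
  adj? i j = does ((toℕ j ≟ (suc (toℕ i)) % n) ⊎-dec (toℕ i ≟ (suc (toℕ j)) % n))

  IsWalk : (ℕ → Fin n) → Set
  IsWalk W = ∀ i → Adj (W i) (W (suc i))

  countT : (ℕ → Bool) → ℕ → ℕ
  countT m zero = zero
  countT m (suc t) = if m t then suc (countT m t) else countT m t

  countF : (ℕ → Bool) → ℕ → ℕ
  countF m zero = zero
  countF m (suc t) = if m t then countF m t else suc (countF m t)

  InfOften : (ℕ → Bool) → Bool → Set
  InfOften m b = ∀ N → ∃ λ k → (N ℕ.≤ k) × (m k ≡ b)

  -- (R , S) is successful: there is an infinite sequence of moves
  -- (m t = true: advance T_R, false: advance T_S) advancing each token
  -- infinitely often, such that the tokens never coincide (including at t = 0).
  Successful : (ℕ → Fin n) → (ℕ → Fin n) → Set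
  Successful R S = Σ (ℕ → Bool) λ m →
    InfOften m true × InfOften m false ×
    (∀ t → ¬ (R (countT m t) ≡ S (countF m t)))

  Extends : (ℕ → Fin n) → List (Fin n) → Set
  Extends R [] = ⊤
  Extends R (x ∷ w) = (x ≡ R 0) × Extends (λ i → R (suc i)) w

  -- Probability, under the random walk (uniform start, uniform neighbour steps;
  -- each vertex of C_n, n ≥ 3, has exactly 2 neighbours), of the cylinder of w.
  stepMass : Fin n → List (Fin n) → ℚ
  stepMass x [] = 1ℚ
  stepMass x (y ∷ w) = (if adj? x y then ½ else 0ℚ) * stepMass y w

  mass : List (Fin n) → ℚ
  mass [] = 1ℚ
  mass (x ∷ w) = ((+ 1) / n) * stepMass x w

  partialSum : (ℕ → ℚ) → ℕ → ℚ
  partialSum f zero = 0ℚ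
  partialSum f (suc N) = partialSum f N + f N

  -- A set P of walks has probability zero under the random walk measure:
  -- for every ε = 1/(e+1) it is covered by countably many cylinders of total
  -- mass ≤ ε (i.e. its outer measure is 0).
  ProbZero : ((ℕ → Fin n) → Set) → Set
  ProbZero P = ∀ (e : ℕ) → Σ (ℕ → List (Fin n)) λ c →
    (∀ R → IsWalk R → P R → ∃ λ i → Extends R (c i)) ×
    (∀ N → partialSum (λ i → mass (c i)) N ≤ ((+ 1) / suc e))

  Evasive : (ℕ → Fin n) → Set
  Evasive S = ¬ ProbZero (λ R → Successful R S)

{-# OPTIONS --safe #-}

-- Lift both walks to ℤ. The tokens avoid each other iff the lifted difference r i - s j stays
-- strictly between two consecutive multiples of n, so the token of S has to imitate every large
-- excursion of R. Given the first t steps of R, let R next either rise by more than 2t + n before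
-- falling by more than 2t, or do the opposite: S, being fixed, can follow at most one of the two.
-- By symmetry each has probability at least a constant c > 0 within a long enough block, so R
-- survives q successive blocks with probability at most (1 - c) ^ q. The number of steps this takes
-- does not depend on S, and a null cover is obtained by listing the step sequences of that length
-- as longer and longer initial segments of S are found to be compatible with them.
module Submission where

open import Defs
open import Data.Bool using (Bool; true; false; not; if_then_else_; _∨_; _∧_; T; T?)
open import Data.Bool.Properties using (T-≡)
open import Data.Empty using (⊥; ⊥-elim)
open import Data.Fin as Fin using (Fin; toℕ; fromℕ; fromℕ<; inject₁)
open import Data.Fin.Properties using (toℕ-injective; toℕ<n; toℕ-fromℕ; toℕ-fromℕ<; toℕ-inject₁)
open import Data.Integer as ℤ using (ℤ; +_; 0ℤ; 1ℤ; -1ℤ; ∣_∣)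
import Data.Integer.Properties as ℤ
import Data.Integer.Tactic.RingSolver as ℤ
open import Data.List as List using (List; []; _∷_; length; filterᵇ; allFin; cartesianProduct)
open import Data.List.Properties using (length-tabulate)
open import Data.List.Membership.Propositional using (_∈_)
open import Data.List.Membership.Propositional.Properties
  using (∈-filter⁺; ∈-map⁺; ∈-++⁺ˡ; ∈-++⁺ʳ; ∈-allFin; ∈-cartesianProduct⁺)
open import Data.List.Relation.Unary.Any using (here; there)
open import Data.Maybe using (Maybe; just; nothing; maybe′)
open import Data.Nat
  using (ℕ; zero; suc; _+_; _*_; _^_; _≤_; _<_; z≤n; s≤s; s≤s⁻¹; _%_; _/_; _⊔_; _≤ᵇ_)
open import Data.Nat.Divisibility using (divides; ∣⇒≤)
open import Data.Nat.DivMod using (m≡m%n+[m/n]*n; m%n<n; m<n⇒m%n≡m; n%n≡0)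
open import Data.Nat.Properties
open import Data.Nat.Tactic.RingSolver using (solve-∀)
open import Data.Product using (∃; _×_; _,_; proj₁; proj₂)
open import Data.Rational as ℚ using (ℚ; 0ℚ; 1ℚ; ½)
import Data.Rational.Properties as ℚ
open import Data.Rational.Unnormalised as ℚᵘ using (mkℚᵘ; *≡*; *≤*)
import Data.Rational.Unnormalised.Properties as ℚᵘ
open import Data.Sum using (_⊎_; inj₁; inj₂)
open import Data.Unit using (tt)
open import Data.Vec using (Vec; []; _∷_; _++_; map)
open import Data.Vec.Properties using (map-++)
open import Function using (_∘_; case_of_; Equivalence)
open import Relation.Nullary using (Dec; yes; no; does; ¬_; contradiction)
open import Relation.Nullary.Decidable using (_×-dec_; _⊎-dec_; map′; dec-true)
open import Relation.Binary.PropositionalEquality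

-- Counting step sequences

private variable
  L : ℕ
  A : Set

indicator : Bool → ℕ
indicator b = if b then 1 else 0

count : (Vec Bool L → Bool) → ℕ
count {zero}  P = indicator (P [])
count {suc L} P = count (P ∘ (true ∷_)) + count (P ∘ (false ∷_))

double-^ : ∀ m → 2 ^ suc m ≡ 2 ^ m + 2 ^ m
double-^ m = cong (λ x → 2 ^ m + x) (+-identityʳ (2 ^ m))

count-none : (P : Vec Bool L → Bool) → (∀ v → P v ≡ false) → count P ≡ 0
count-none {zero}  P none rewrite none [] = refl
count-none {suc L} P none =
  cong₂ _+_ (count-none _ (none ∘ (true ∷_))) (count-none _ (none ∘ (false ∷_)))

count-all : count {L} (λ _ → true) ≡ 2 ^ L
count-all {zero}  = refl
count-all {suc L} = trans (cong₂ _+_ (count-all {L}) (count-all {L})) (sym (double-^ L))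

count-disjoint : (P Q : Vec Bool L → Bool) →
  (∀ v → P v ≡ true → Q v ≡ true → ⊥) → count P + count Q ≤ 2 ^ L
count-disjoint {zero} P Q disj with P [] in p | Q [] in q
... | true  | true  = ⊥-elim (disj [] p q)
... | true  | false = ≤-refl
... | false | true  = ≤-refl
... | false | false = z≤n
count-disjoint {suc L} P Q disj = begin
  (p₁ + p₀) + (q₁ + q₀)  ≡⟨ rearrange p₁ p₀ q₁ q₀ ⟩
  (p₁ + q₁) + (p₀ + q₀)  ≤⟨ +-mono-≤ (count-disjoint _ _ (disj ∘ (true ∷_)))
                                      (count-disjoint _ _ (disj ∘ (false ∷_))) ⟩
  2 ^ L + 2 ^ L          ≡⟨ double-^ L ⟨
  2 ^ suc L              ∎
  where
  open ≤-Reasoning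
  p₁ = count (P ∘ (true ∷_))
  p₀ = count (P ∘ (false ∷_))
  q₁ = count (Q ∘ (true ∷_))
  q₀ = count (Q ∘ (false ∷_))
  rearrange : ∀ a b c d → (a + b) + (c + d) ≡ (a + c) + (b + d)
  rearrange = solve-∀

count-flip : (P : Vec Bool L → Bool) → count (P ∘ map not) ≡ count P
count-flip {zero}  P = refl
count-flip {suc L} P = trans
  (cong₂ _+_ (count-flip (P ∘ (false ∷_))) (count-flip (P ∘ (true ∷_))))
  (+-comm (count (P ∘ (false ∷_))) _)

-- Exhaustive search makes the case distinction in `block` constructive.
search : (P : Vec Bool L → Bool) → (∀ v → P v ≡ false) ⊎ ∃ λ v → P v ≡ true
search {zero} P with P [] in p
... | true  = inj₂ ([] , p)
... | false = inj₁ λ { [] → p }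
search {suc L} P with search (P ∘ (true ∷_)) | search (P ∘ (false ∷_))
... | inj₂ (v , p) | _            = inj₂ (true ∷ v , p)
... | inj₁ _       | inj₂ (v , p) = inj₂ (false ∷ v , p)
... | inj₁ n₁      | inj₁ n₀      = inj₁ λ { (true ∷ v) → n₁ v ; (false ∷ v) → n₀ v }

-- The law of total probability with denominators cleared: `X / C` bounds the number of good
-- continuations of a prefix in `Q`, and for positive `C` a prefix outside `Q` has none. Summing
-- over all prefixes gives the claim.
count-++ : ∀ {t m} C X (P : Vec Bool (t + m) → Bool) (Q : Vec Bool t → Bool) →
  (∀ w → count (P ∘ (w ++_)) * C ≤ X * indicator (Q w)) → count P * C ≤ X * count Q
count-++ {zero}  C X P Q bound = bound []
count-++ {suc t} C X P Q bound = begin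
  (p₁ + p₀) * C      ≡⟨ *-distribʳ-+ C p₁ p₀ ⟩
  p₁ * C + p₀ * C    ≤⟨ +-mono-≤ (count-++ {t} C X _ (Q ∘ (true ∷_)) (bound ∘ (true ∷_)))
                                 (count-++ {t} C X _ (Q ∘ (false ∷_)) (bound ∘ (false ∷_))) ⟩
  X * q₁ + X * q₀    ≡⟨ *-distribˡ-+ X q₁ q₀ ⟨
  X * (q₁ + q₀)      ∎
  where
  open ≤-Reasoning
  p₁ = count (P ∘ (true ∷_))
  p₀ = count (P ∘ (false ∷_))
  q₁ = count (Q ∘ (true ∷_))
  q₀ = count (Q ∘ (false ∷_))

-- Exponential decay and exits of the ±1 walk from an interval

-- Bernoulli's inequality `1 + q / b ≤ (1 + 1 / b) ^ q`, multiplied by `b ^ (q + 1)`.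
bernoulli : ∀ b q → b ^ q * (b + q) ≤ b * suc b ^ q
bernoulli b zero    = ≤-reflexive (trans (+-identityʳ (b + 0)) (trans (+-identityʳ b) (sym (*-identityʳ b))))
bernoulli b (suc q) = begin
  (b * b ^ q) * (b + suc q)              ≡⟨ expand b q (b ^ q) ⟩
  b * (b ^ q * (b + q)) + b ^ q * b      ≤⟨ +-monoʳ-≤ (b * (b ^ q * (b + q))) (*-monoʳ-≤ (b ^ q) (m≤m+n b q)) ⟩
  b * (b ^ q * (b + q)) + b ^ q * (b + q) ≡⟨ +-comm _ (b ^ q * (b + q)) ⟩
  suc b * (b ^ q * (b + q))              ≤⟨ *-monoʳ-≤ (suc b) (bernoulli b q) ⟩
  suc b * (b * suc b ^ q)                ≡⟨ swap (suc b) b (suc b ^ q) ⟩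
  b * (suc b * suc b ^ q)                ∎
  where
  open ≤-Reasoning
  expand : ∀ b q p → (b * p) * (b + suc q) ≡ b * (p * (b + q)) + p * b
  expand = solve-∀
  swap : ∀ x y z → x * (y * z) ≡ y * (x * z)
  swap = solve-∀

geometric-decay : ∀ b K → ∃ λ q → b ^ q * K ≤ suc b ^ q
geometric-decay zero    K = 1 , z≤n
geometric-decay b@(suc _) K = q , *-cancelˡ-≤ b (begin
  b * (b ^ q * K)       ≡⟨ swap b (b ^ q) K ⟩
  b ^ q * (b * K)       ≤⟨ *-monoʳ-≤ (b ^ q) (m≤n+m (b * K) b) ⟩
  b ^ q * (b + b * K)   ≤⟨ bernoulli b q ⟩
  b * suc b ^ q         ∎)
  where
  open ≤-Reasoning
  -- With this `q`, Bernoulli gives `(1 + 1 / b) ^ q ≥ 1 + K`.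
  q = b * K
  swap : ∀ x y z → x * (y * z) ≡ y * (x * z)
  swap = solve-∀

-- The ±1 walk with steps v (true = +1) hits +a before hitting -(1 + b).
hitsUp : ℕ → ℕ → Vec Bool L → Bool
hitsUp zero    b       v           = true
hitsUp (suc a) b       []          = false
hitsUp (suc a) b       (true ∷ v)  = hitsUp a (suc b) v
hitsUp (suc a) zero    (false ∷ v) = false
hitsUp (suc a) (suc b) (false ∷ v) = hitsUp (suc (suc a)) b v

-- Number of ±1 walks of m steps staying within [-b , a].
confined : ℕ → ℕ → ℕ → ℕ
confined a       b       zero    = 1
confined zero    zero    (suc m) = 0
confined zero    (suc b) (suc m) = confined 1 b m
confined (suc a) zero    (suc m) = confined a 1 m
confined (suc a) (suc b) (suc m) = confined a (suc (suc b)) m + confined (suc (suc a)) b m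

ups : ℕ → ℕ → ℕ → ℕ
ups a b m = count {m} (hitsUp a b)

-- A walk leaves `[-b , a]` through the top, leaves it through the bottom, or stays. Exits through
-- the bottom are counted by their mirror images, which is why `a` and `b` trade places in the
-- second term. The induction is on the first step.
exit-trichotomy : ∀ m a b → 2 ^ m ≤ (ups (suc a) b m + ups (suc b) a m) + confined a b m
exit-trichotomy zero    a       b       = ≤-refl
exit-trichotomy (suc m) zero    zero    = begin
  2 ^ suc m                                    ≡⟨ double-^ m ⟩
  2 ^ m + 2 ^ m                                ≡⟨ cong₂ _+_ (count-all {m}) (count-all {m}) ⟨
  ups 0 1 m + ups 0 1 m                        ≤⟨ +-mono-≤ (m≤m+n (ups 0 1 m) _) (m≤m+n (ups 0 1 m) _) ⟩
  ups 1 0 (suc m) + ups 1 0 (suc m)            ≡⟨ +-identityʳ _ ⟨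
  ups 1 0 (suc m) + ups 1 0 (suc m) + 0        ∎
  where open ≤-Reasoning
exit-trichotomy (suc m) zero    (suc b) = begin
  2 ^ suc m                                    ≡⟨ double-^ m ⟩
  2 ^ m + 2 ^ m                                ≤⟨ +-mono-≤ (≤-reflexive (sym (count-all {m}))) (exit-trichotomy m 1 b) ⟩
  ups 0 (suc (suc b)) m + ((ups 2 b m + ups (suc b) 1 m) + confined 1 b m)
    ≡⟨ regroup (ups 0 (suc (suc b)) m) (ups 2 b m) (ups (suc b) 1 m) (confined 1 b m) ⟩
  ((ups 0 (suc (suc b)) m + ups 2 b m) + (ups (suc b) 1 m + 0)) + confined 1 b m
    ≤⟨ +-monoˡ-≤ (confined 1 b m) (+-monoʳ-≤ (ups 0 (suc (suc b)) m + ups 2 b m) (+-monoʳ-≤ (ups (suc b) 1 m) z≤n)) ⟩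
  (ups 1 (suc b) (suc m) + ups (suc (suc b)) 0 (suc m)) + confined 1 b m ∎
  where
  open ≤-Reasoning
  regroup : ∀ p q r s → p + ((q + r) + s) ≡ ((p + q) + (r + 0)) + s
  regroup = solve-∀
exit-trichotomy (suc m) (suc a) zero    = begin
  2 ^ suc m                                    ≡⟨ double-^ m ⟩
  2 ^ m + 2 ^ m                                ≤⟨ +-mono-≤ (≤-reflexive (sym (count-all {m}))) (exit-trichotomy m a 1) ⟩
  ups 0 (suc (suc a)) m + ((ups (suc a) 1 m + ups 2 a m) + confined a 1 m)
    ≡⟨ regroup (ups 0 (suc (suc a)) m) (ups (suc a) 1 m) (ups 2 a m) (confined a 1 m) ⟩
  ((ups (suc a) 1 m + 0) + (ups 0 (suc (suc a)) m + ups 2 a m)) + confined a 1 m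
    ≤⟨ +-monoˡ-≤ (confined a 1 m) (+-monoˡ-≤ (ups 0 (suc (suc a)) m + ups 2 a m) (+-monoʳ-≤ (ups (suc a) 1 m) z≤n)) ⟩
  (ups (suc (suc a)) 0 (suc m) + ups 1 (suc a) (suc m)) + confined a 1 m ∎
  where
  open ≤-Reasoning
  regroup : ∀ p q r s → p + ((q + r) + s) ≡ ((q + 0) + (p + r)) + s
  regroup = solve-∀
exit-trichotomy (suc m) (suc a) (suc b) = begin
  2 ^ suc m        ≡⟨ double-^ m ⟩
  2 ^ m + 2 ^ m    ≤⟨ +-mono-≤ (exit-trichotomy m a (suc (suc b))) (exit-trichotomy m (suc (suc a)) b) ⟩
  ((ups (suc a) (suc (suc b)) m + ups (suc (suc (suc b))) a m) + confined a (suc (suc b)) m) +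
  ((ups (suc (suc (suc a))) b m + ups (suc b) (suc (suc a)) m) + confined (suc (suc a)) b m)
    ≡⟨ regroup (ups (suc a) (suc (suc b)) m) (ups (suc (suc (suc b))) a m) (confined a (suc (suc b)) m)
               (ups (suc (suc (suc a))) b m) (ups (suc b) (suc (suc a)) m) (confined (suc (suc a)) b m) ⟩
  _                ∎
  where
  open ≤-Reasoning
  regroup : ∀ p q r s u v →
    ((p + q) + r) + ((s + u) + v) ≡ ((p + s) + (u + q)) + (r + v)
  regroup = solve-∀

-- A step moves the walker inside the interval but keeps the width `a + b`, so a bound uniform in
-- the position can be applied after each of the `2 ^ k` beginnings.
confined-≤ : ∀ W m X → (∀ a b → a + b ≡ W → confined a b m ≤ X) →
  ∀ k a b → a + b ≡ W → confined a b (k + m) ≤ 2 ^ k * X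
confined-≤ W m X base zero    a b eq = ≤-trans (base a b eq) (≤-reflexive (sym (*-identityˡ X)))
confined-≤ W m X base (suc k) a b eq = begin
  confined a b (suc k + m)     ≤⟨ split a b eq ⟩
  2 ^ k * X + 2 ^ k * X        ≡⟨ *-distribʳ-+ X (2 ^ k) (2 ^ k) ⟨
  (2 ^ k + 2 ^ k) * X          ≡⟨ cong (_* X) (double-^ k) ⟨
  2 ^ suc k * X                ∎
  where
  open ≤-Reasoning
  rec = confined-≤ W m X base k
  split : ∀ a b → a + b ≡ W → confined a b (suc k + m) ≤ 2 ^ k * X + 2 ^ k * X
  split zero    zero    eq = z≤n
  split zero    (suc b) eq = ≤-trans (rec 1 b eq) (m≤m+n _ _)
  split (suc a) zero    eq = ≤-trans (rec a 1 (trans (+-suc a 0) eq)) (m≤m+n _ _)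
  split (suc a) (suc b) eq = +-mono-≤
    (rec a (suc (suc b)) (trans (+-suc a (suc b)) eq))
    (rec (suc (suc a)) b (trans (sym (cong suc (+-suc a b))) eq))

-- Going up a + 1 times in a row leaves [-b , a], so one of the first 2 ^ k continuations is lost.
confined-< : ∀ W m X → (∀ a b → a + b ≡ W → confined a b m ≤ X) →
  ∀ k a b → a + b ≡ W → a < k → confined a b (k + m) + X ≤ 2 ^ k * X
confined-< W m X base (suc k) a b eq a<k = begin
  confined a b (suc k + m) + X  ≤⟨ split a b eq (s≤s⁻¹ a<k) ⟩
  2 ^ k * X + 2 ^ k * X         ≡⟨ *-distribʳ-+ X (2 ^ k) (2 ^ k) ⟨
  (2 ^ k + 2 ^ k) * X           ≡⟨ cong (_* X) (double-^ k) ⟨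
  2 ^ suc k * X                 ∎
  where
  open ≤-Reasoning
  X≤ : X ≤ 2 ^ k * X
  X≤ = m≤n*m X (2 ^ k) {{m^n≢0 2 k}}
  all = confined-≤ W m X base k
  swap : ∀ x y z → x + y + z ≡ x + z + y
  swap = solve-∀
  split : ∀ a b → a + b ≡ W → a ≤ k → confined a b (suc k + m) + X ≤ 2 ^ k * X + 2 ^ k * X
  split zero    zero    eq _   = ≤-trans X≤ (m≤m+n _ _)
  split zero    (suc b) eq _   = +-mono-≤ (all 1 b eq) X≤
  split (suc a) zero    eq a≤k = ≤-trans
    (confined-< W m X base k a 1 (trans (+-suc a 0) eq) a≤k) (m≤m+n _ _)
  split (suc a) (suc b) eq a≤k = ≤-trans
    (≤-reflexive (swap (confined a (suc (suc b)) (k + m)) _ X))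
    (+-mono-≤ (confined-< W m X base k a (suc (suc b)) (trans (+-suc a (suc b)) eq) a≤k)
              (all (suc (suc a)) b (trans (sym (cong suc (+-suc a b))) eq)))

-- Cut the walk into blocks of `W + 1` steps. From any position at least one of the `2 ^ (W + 1)`
-- step patterns of a block leaves the interval, so at most `B` patterns remain for each block.
confined-^ : ∀ W B → 2 ^ suc W ≡ suc B → ∀ q a b → a + b ≡ W → confined a b (q * suc W) ≤ B ^ q
confined-^ W B B≡ zero    a b eq = ≤-refl
confined-^ W B B≡ (suc q) a b eq = +-cancelʳ-≤ (B ^ q) _ _ (begin
  confined a b (suc W + q * suc W) + B ^ q
    ≤⟨ confined-< W (q * suc W) (B ^ q) (confined-^ W B B≡ q) (suc W) a b eq
         (s≤s (≤-trans (m≤m+n a b) (≤-reflexive eq))) ⟩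
  2 ^ suc W * B ^ q    ≡⟨ cong (_* B ^ q) B≡ ⟩
  B ^ q + B * B ^ q    ≡⟨ +-comm (B ^ q) _ ⟩
  B ^ suc q + B ^ q    ∎)
  where open ≤-Reasoning

-- `2 ^ L - 1`, in a form that is convenient for denominators given by their predecessors: the
-- recursion is the denominator that `fraction-*` yields for a product with one half.
pred-2^ : ℕ → ℕ
pred-2^ zero    = 0
pred-2^ (suc L) = pred-2^ L + 1 * suc (pred-2^ L)

suc-pred-2^ : ∀ L → suc (pred-2^ L) ≡ 2 ^ L
suc-pred-2^ zero    = refl
suc-pred-2^ (suc L) = cong (2 *_) (suc-pred-2^ L)

confined-half : ∀ a b → ∃ λ m → confined a b m * 2 ≤ 2 ^ m
confined-half a b with geometric-decay (pred-2^ (suc (a + b))) 2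
... | q , decay = q * suc (a + b) , (begin
  confined a b (q * suc (a + b)) * 2   ≤⟨ *-monoˡ-≤ 2 (confined-^ (a + b) B (sym B≡) q a b refl) ⟩
  B ^ q * 2                            ≤⟨ decay ⟩
  suc B ^ q                            ≡⟨ cong (_^ q) B≡ ⟩
  (2 ^ suc (a + b)) ^ q                ≡⟨ ^-*-assoc 2 (suc (a + b)) q ⟩
  2 ^ (suc (a + b) * q)                ≡⟨ cong (2 ^_) (*-comm (suc (a + b)) q) ⟩
  2 ^ (q * suc (a + b))                ∎)
  where
  open ≤-Reasoning
  B = pred-2^ (suc (a + b))
  B≡ = suc-pred-2^ (suc (a + b))

ups-straight : ∀ n b m → 2 ^ m ≤ ups n b (n + m)
ups-straight zero    b m = ≤-reflexive (sym (count-all {m}))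
ups-straight (suc n) b m = ≤-trans (ups-straight n (suc b) m) (m≤m+n _ _)

-- Insert `n` up-steps right after the walk first hits `a`: distinct walks stay distinct, and the
-- new ones hit `a + n` within `n + m` steps.
ups-extend : ∀ n m a b → ups a b m ≤ ups (a + n) b (n + m)
ups-extend n m zero    b = ≤-trans (≤-reflexive (count-all {m})) (ups-straight n b m)
ups-extend n zero    (suc a) b = z≤n
ups-extend n (suc m) (suc a) b rewrite +-suc n m = +-mono-≤ (ups-extend n m a (suc b)) (lower b)
  where
  lower : ∀ b → count {m} (λ v → hitsUp (suc a) b (false ∷ v)) ≤
                count {n + m} (λ v → hitsUp (suc (a + n)) b (false ∷ v))
  lower zero    = ≤-trans (≤-reflexive (count-none {m} _ (λ _ → refl))) z≤n
  lower (suc b) = ups-extend n m (suc (suc a)) b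

-- For long enough walks at least half leave `[-b , b]`, hence by symmetry at least a quarter leave
-- it through the top; climbing `n` further costs a factor `2 ^ n`. The constant is independent of
-- `b`, which grows with the elapsed time in the application.
ups-lower : ∀ n b → ∃ λ m → 2 ^ m ≤ ups (suc b + n) b m * (4 * 2 ^ n)
ups-lower n b with confined-half b b
... | m , half = n + m , (begin
  2 ^ (n + m)                        ≡⟨ ^-distribˡ-+-* 2 n m ⟩
  2 ^ n * 2 ^ m                      ≤⟨ *-monoʳ-≤ (2 ^ n) quarter ⟩
  2 ^ n * (u * 4)                    ≡⟨ assoc (2 ^ n) u ⟩
  u * (4 * 2 ^ n)                    ≤⟨ *-monoˡ-≤ (4 * 2 ^ n) (ups-extend n m (suc b) b) ⟩
  ups (suc b + n) b (n + m) * (4 * 2 ^ n) ∎)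
  where
  open ≤-Reasoning
  u = ups (suc b) b m
  assoc : ∀ x y → x * (y * 4) ≡ y * (4 * x)
  assoc = solve-∀
  regroup : ∀ u e → ((u + u) + e) * 2 ≡ u * 4 + e * 2
  regroup = solve-∀
  quarter : 2 ^ m ≤ u * 4
  quarter = +-cancelʳ-≤ (2 ^ m) _ _ (begin
    2 ^ m + 2 ^ m                    ≡⟨ double-^ m ⟨
    2 * 2 ^ m                        ≡⟨ *-comm 2 (2 ^ m) ⟩
    2 ^ m * 2                        ≤⟨ *-monoˡ-≤ 2 (exit-trichotomy m b b) ⟩
    ((u + u) + confined b b m) * 2   ≡⟨ regroup u (confined b b m) ⟩
    u * 4 + confined b b m * 2       ≤⟨ +-monoʳ-≤ (u * 4) half ⟩
    u * 4 + 2 ^ m                    ∎)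

-- Survival through successive blocks

PrefixClosed : (∀ {L} → Vec Bool L → Bool) → Set
PrefixClosed P = ∀ {t m} (w : Vec Bool t) (v : Vec Bool m) → P (w ++ v) ≡ true → P w ≡ true

-- After any t steps, a large rise and a large fall cannot both keep P alive.
OneSided : ℕ → (∀ {L} → Vec Bool L → Bool) → Set
OneSided n P = ∀ {t m} (w : Vec Bool t) (v v′ : Vec Bool m) →
  hitsUp (suc (t + t) + n) (t + t) v ≡ true → hitsUp (suc (t + t) + n) (t + t) (map not v′) ≡ true →
  P (w ++ v) ≡ true → P (w ++ v′) ≡ true → ⊥

module _ (n : ℕ) where

  -- The odds against a large rise: within a block it has probability at least `1 / (odds + 1)`.
  odds : ℕ
  odds = pred-2^ (2 + n)

  odds≡ : 4 * 2 ^ n ≡ suc odds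
  odds≡ = trans (*-assoc 2 2 (2 ^ n)) (sym (suc-pred-2^ (2 + n)))

  blockLength : ℕ → ℕ
  blockLength t = proj₁ (ups-lower n (t + t))

  -- Blocks have to be chosen one after the other, because the height of the required rise depends
  -- on the number of steps taken before.
  stageLength : ℕ → ℕ
  stageLength zero    = 0
  stageLength (suc q) = stageLength q + blockLength (stageLength q)

  module _ (P : ∀ {L} → Vec Bool L → Bool) (closed : PrefixClosed P) (one-sided : OneSided n P) where

    -- A dead prefix has only dead continuations. A living one loses at least the fraction
    -- `1 / (odds + 1)` of its continuations, namely all large rises or all large falls.
    block : ∀ t (w : Vec Bool t) → let m = blockLength t in
      count {m} (λ v → P (w ++ v)) * suc odds ≤ 2 ^ m * odds * indicator (P w)
    block t w with P w in Pw
    ... | false = ≤-trans (≤-reflexive (cong (_* suc odds) (count-none {blockLength t} _ none))) z≤n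
      where
      none : ∀ v → P (w ++ v) ≡ false
      none v with P (w ++ v) in Pwv
      ... | false = refl
      ... | true  = case trans (sym (closed w v Pwv)) Pw of λ ()
    ... | true  = ≤-trans (+-cancelʳ-≤ (2 ^ m) _ _ (begin
      count Q * suc odds + 2 ^ m         ≤⟨ +-monoʳ-≤ (count Q * suc odds) (proj₂ (ups-lower n (t + t))) ⟩
      count Q * suc odds + u * (4 * 2 ^ n) ≡⟨ cong (λ c → count Q * suc odds + u * c) odds≡ ⟩
      count Q * suc odds + u * suc odds     ≡⟨ *-distribʳ-+ (suc odds) (count Q) u ⟨
      (count Q + u) * suc odds           ≤⟨ *-monoˡ-≤ (suc odds) room ⟩
      2 ^ m * suc odds                   ≡⟨ trans (*-suc (2 ^ m) odds) (+-comm (2 ^ m) _) ⟩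
      2 ^ m * odds + 2 ^ m               ∎)) (≤-reflexive (sym (*-identityʳ _)))
      where
      open ≤-Reasoning
      m = blockLength t
      Q : Vec Bool m → Bool
      Q v = P (w ++ v)
      U : Vec Bool m → Bool
      U = hitsUp (suc (t + t) + n) (t + t)
      u = count U
      both : Vec Bool m → Bool
      both v = if U v then Q v else false
      both-true : ∀ v → U v ≡ true → Q v ≡ true → both v ≡ true
      both-true v Uv Qv rewrite Uv = Qv
      room : count Q + u ≤ 2 ^ m
      -- If no large rise survives, the survivors are disjoint from `U`. If one does, it rules out
      -- every large fall, and the falls are as numerous as the rises by reflection.
      room with search both
      ... | inj₁ none = count-disjoint Q U λ v Qv Uv →
        case trans (sym (both-true v Uv Qv)) (none v) of λ ()
      ... | inj₂ (v , both-v) with U v in Uv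
      ...   | true = ≤-trans
        (≤-reflexive (cong (λ c → count Q + c) (sym (count-flip U))))
        (count-disjoint Q (U ∘ map not) λ v′ Qv′ Uv′ → one-sided w v v′ Uv Uv′ both-v Qv′)

    -- The factor `odds / (odds + 1)` of each block, multiplied over `q` blocks.
    stage : ∀ q → count (P {stageLength q}) * suc odds ^ q ≤ odds ^ q * 2 ^ stageLength q
    stage zero with P []
    ... | true  = ≤-refl
    ... | false = z≤n
    stage (suc q) = begin
      count (P {t + m}) * (suc odds * suc odds ^ q)  ≡⟨ *-assoc (count (P {t + m})) (suc odds) _ ⟨
      count (P {t + m}) * suc odds * suc odds ^ q    ≤⟨ *-monoˡ-≤ (suc odds ^ q) (count-++ {t} {m} (suc odds) (2 ^ m * odds) P P (block t)) ⟩
      2 ^ m * odds * count (P {t}) * suc odds ^ q    ≡⟨ *-assoc (2 ^ m * odds) _ _ ⟩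
      2 ^ m * odds * (count (P {t}) * suc odds ^ q)  ≤⟨ *-monoʳ-≤ (2 ^ m * odds) (stage q) ⟩
      2 ^ m * odds * (odds ^ q * 2 ^ t)              ≡⟨ regroup (2 ^ m) odds (odds ^ q) (2 ^ t) ⟩
      odds * odds ^ q * (2 ^ t * 2 ^ m)              ≡⟨ cong (odds ^ suc q *_) (^-distribˡ-+-* 2 t m) ⟨
      odds ^ suc q * 2 ^ (t + m)                  ∎
      where
      open ≤-Reasoning
      t = stageLength q
      m = blockLength t
      regroup : ∀ x y z u → x * y * (z * u) ≡ y * z * (u * x)
      regroup = solve-∀

  -- The length is chosen before `P`, so a single `L` serves `alive T z` for all `T` and `z`.
  one-sided-rare : ∀ K → ∃ λ L → ∀ (P : ∀ {L} → Vec Bool L → Bool) →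
    PrefixClosed P → OneSided n P → count (P {L}) * K ≤ 2 ^ L
  one-sided-rare K with geometric-decay odds K
  ... | q , decay = stageLength q , λ P closed one-sided →
    *-cancelʳ-≤ _ _ (suc odds ^ q) {{m^n≢0 (suc odds) q}} (begin
      count (P {stageLength q}) * K * suc odds ^ q               ≡⟨ swap (count (P {stageLength q})) K (suc odds ^ q) ⟩
      count (P {stageLength q}) * suc odds ^ q * K               ≤⟨ *-monoˡ-≤ K (stage P closed one-sided q) ⟩
      odds ^ q * 2 ^ stageLength q * K         ≡⟨ swap (odds ^ q) _ K ⟩
      odds ^ q * K * 2 ^ stageLength q         ≤⟨ *-monoˡ-≤ (2 ^ stageLength q) decay ⟩
      suc odds ^ q * 2 ^ stageLength q         ≡⟨ *-comm (suc odds ^ q) _ ⟩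
      2 ^ stageLength q * suc odds ^ q         ∎)
    where
    open ≤-Reasoning
    swap : ∀ x y z → x * y * z ≡ x * z * y
    swap = solve-∀

-- Lifts to ℤ

move : Bool → ℤ → ℤ
move true  = ℤ.suc
move false = ℤ.pred

-- Frozen at its endpoint from index L on.
path : ℤ → Vec Bool L → ℕ → ℤ
path z bs       zero    = z
path z []       (suc i) = z
path z (b ∷ bs) (suc i) = path (move b z) bs i

endpoint : ℤ → Vec Bool L → ℤ
endpoint z []       = z
endpoint z (b ∷ bs) = endpoint (move b z) bs

neg-move : ∀ b z → ℤ.- move b z ≡ move (not b) (ℤ.- z)
neg-move true  z = ℤ.neg-distrib-+ 1ℤ z
neg-move false z = ℤ.neg-distrib-+ -1ℤ z

path-flip : ∀ z (bs : Vec Bool L) i → path (ℤ.- z) (map not bs) i ≡ ℤ.- path z bs i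
path-flip z []       zero    = refl
path-flip z (b ∷ bs) zero    = refl
path-flip z []       (suc i) = refl
path-flip z (b ∷ bs) (suc i) =
  trans (cong (λ y → path y (map not bs) i) (sym (neg-move b z))) (path-flip (move b z) bs i)

endpoint-flip : ∀ z (bs : Vec Bool L) → endpoint (ℤ.- z) (map not bs) ≡ ℤ.- endpoint z bs
endpoint-flip z []       = refl
endpoint-flip z (b ∷ bs) =
  trans (cong (λ y → endpoint y (map not bs)) (sym (neg-move b z))) (endpoint-flip (move b z) bs)

path-++ : ∀ {t m} z (w : Vec Bool t) (v : Vec Bool m) i → i ≤ t → path z (w ++ v) i ≡ path z w i
path-++ z []      v zero    _   = refl
path-++ z (_ ∷ _) v zero    _   = refl
path-++ z (b ∷ w) v (suc i) i≤t = path-++ (move b z) w v i (s≤s⁻¹ i≤t)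

shift-suc : ∀ x y → x ℤ.+ (1ℤ ℤ.+ y) ≡ 1ℤ ℤ.+ (x ℤ.+ y)
shift-suc = ℤ.solve-∀

move-lower : ∀ b {x z} d → x ℤ.+ + suc d ℤ.≤ z → x ℤ.+ + d ℤ.≤ move b z
move-lower true {x} {z} d le = ℤ.≤-trans
  (ℤ.≤-trans (ℤ.i≤suc[i] (x ℤ.+ + d)) (ℤ.≤-reflexive (sym (shift-suc x (+ d)))))
  (ℤ.≤-trans le (ℤ.i≤suc[i] z))
move-lower false {x} {z} d le =
  ℤ.i<j⇒i≤pred[j] (ℤ.suc[i]≤j⇒i<j (ℤ.≤-trans (ℤ.≤-reflexive (sym (shift-suc x (+ d)))) le))

endpoint-upper : ∀ z (bs : Vec Bool L) → endpoint z bs ℤ.≤ z ℤ.+ + L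
endpoint-upper z []       = ℤ.≤-reflexive (sym (ℤ.+-identityʳ z))
endpoint-upper {suc L} z (b ∷ bs) =
  ℤ.≤-trans (endpoint-upper (move b z) bs)
    (ℤ.≤-trans (ℤ.+-monoˡ-≤ (+ L) (move-≤ b)) (ℤ.≤-reflexive (swap z (+ L))))
  where
  swap : ∀ x y → (1ℤ ℤ.+ x) ℤ.+ y ≡ x ℤ.+ (1ℤ ℤ.+ y)
  swap = ℤ.solve-∀
  move-≤ : ∀ b → move b z ℤ.≤ ℤ.suc z
  move-≤ true  = ℤ.≤-refl
  move-≤ false = ℤ.≤-trans (ℤ.i≤j⇒pred[i]≤j ℤ.≤-refl) (ℤ.i≤suc[i] z)

Rises : ∀ {L} → ℤ → Vec Bool L → (lo top : ℤ) → Set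
Rises {L} z bs lo top = ∃ λ i → i ≤ L × top ℤ.≤ path z bs i × (∀ k → k ≤ i → lo ℤ.≤ path z bs k)

rises-∷ : ∀ {L z lo top} b (bs : Vec Bool L) → lo ℤ.≤ z → Rises (move b z) bs lo top → Rises z (b ∷ bs) lo top
rises-∷ b bs lo≤z (i , i≤L , top≤ , low) =
  suc i , s≤s i≤L , top≤ , λ { zero _ → lo≤z ; (suc k) k≤i → low k (s≤s⁻¹ k≤i) }

-- Before the hit the walk stays at or above `z - b`. The floor `lo` is kept as a fixed parameter,
-- because `z`, `a` and `b` all change along the induction.
rises-up : ∀ {L} a b (bs : Vec Bool L) z lo → lo ℤ.+ + b ℤ.≤ z → hitsUp a b bs ≡ true →
  Rises z bs lo (z ℤ.+ + a)
rises-up zero b bs z lo le hit =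
  0 , z≤n , ℤ.≤-reflexive (ℤ.+-identityʳ z) , λ { zero z≤n → ℤ.≤-trans (ℤ.i≤i+j lo (+ b)) le }
rises-up (suc a) b (true ∷ bs) z lo le hit = rises-∷ true bs (ℤ.≤-trans (ℤ.i≤i+j lo (+ b)) le)
  (subst (Rises _ bs lo) (assoc z (+ a)) (rises-up a (suc b) bs (ℤ.suc z) lo
    (ℤ.≤-trans (ℤ.≤-reflexive (shift-suc lo (+ b))) (ℤ.suc-mono le)) hit))
  where
  assoc : ∀ x y → (1ℤ ℤ.+ x) ℤ.+ y ≡ x ℤ.+ (1ℤ ℤ.+ y)
  assoc = ℤ.solve-∀
rises-up (suc a) (suc b) (false ∷ bs) z lo le hit =
  rises-∷ false bs (ℤ.≤-trans (ℤ.i≤i+j lo (+ suc b)) le)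
  (subst (Rises _ bs lo) (assoc z (+ a)) (rises-up (suc (suc a)) b bs (ℤ.pred z) lo
    (move-lower false {lo} b le) hit))
  where
  assoc : ∀ x y → (-1ℤ ℤ.+ x) ℤ.+ (1ℤ ℤ.+ (1ℤ ℤ.+ y)) ≡ x ℤ.+ (1ℤ ℤ.+ y)
  assoc = ℤ.solve-∀

-- The floor must also hold during `w`; `t` steps descend by at most `t`, so `lo + t ≤ z` is enough.
rises-after : ∀ {t m} a b (w : Vec Bool t) (v : Vec Bool m) z lo →
  lo ℤ.+ + t ℤ.≤ z → lo ℤ.+ + b ℤ.≤ endpoint z w → hitsUp a b v ≡ true →
  Rises z (w ++ v) lo (endpoint z w ℤ.+ + a)
rises-after a b [] v z lo _ le hit = rises-up a b v z lo le hit
rises-after {suc t} a b (x ∷ w) v z lo start le hit =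
  rises-∷ x (w ++ v) (ℤ.≤-trans (ℤ.i≤i+j lo (+ suc t)) start)
    (rises-after a b w v (move x z) lo (move-lower x {lo} t start) le hit)

module _ (n t : ℕ) where

  -- The first `t` steps stay within `t` of `z`, hence within `2t` of their endpoint, so the floor
  -- `2t` below the endpoint covers the prefix as well. A rise exceeds a fall by `n + 1`, one more
  -- than the slack between the two tokens.
  rise fall : ℕ
  rise = suc (t + t) + n
  fall = t + t

  block-rise : ∀ {m} (w : Vec Bool t) (v : Vec Bool m) z → hitsUp rise fall v ≡ true →
    Rises z (w ++ v) (endpoint z w ℤ.- + fall) (endpoint z w ℤ.+ + rise)
  block-rise w v z = rises-after rise fall w v z _ (ℤ.≤-trans
    (ℤ.+-monoˡ-≤ (+ t) (ℤ.+-monoˡ-≤ (ℤ.- + fall) (endpoint-upper z w)))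
    (ℤ.≤-reflexive (cancel z (+ t)))) (ℤ.≤-reflexive (cancel′ (endpoint z w) (+ fall)))
    where
    cancel : ∀ z t → z ℤ.+ t ℤ.- (t ℤ.+ t) ℤ.+ t ≡ z
    cancel = ℤ.solve-∀
    cancel′ : ∀ z t → z ℤ.- t ℤ.+ t ≡ z
    cancel′ = ℤ.solve-∀

  -- This is `block-rise` for the walk reflected at 0, with all inequalities negated.
  block-fall : ∀ {m} (w : Vec Bool t) (v : Vec Bool m) z → hitsUp rise fall (map not v) ≡ true →
    ∃ λ i → i ≤ t + m × path z (w ++ v) i ℤ.≤ endpoint z w ℤ.- + rise ×
      (∀ k → k ≤ i → path z (w ++ v) k ℤ.≤ endpoint z w ℤ.+ + fall)
  block-fall w v z hit
    with i , i≤ , bottom , high ← block-rise (map not w) (map not v) (ℤ.- z) hit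
    rewrite endpoint-flip z w | sym (map-++ not w v)
    = i , i≤ , flip≤ (+ rise) bottom , λ k k≤i → ℤ.neg-cancel-≤ (subst₂ ℤ._≤_
        (sym (ℤ.neg-distrib-+ (endpoint z w) (+ fall))) (path-flip z (w ++ v) k) (high k k≤i))
    where
    double-neg : ∀ e a → ℤ.- (e ℤ.- a) ≡ ℤ.- e ℤ.+ a
    double-neg = ℤ.solve-∀
    flip≤ : ∀ a → ℤ.- endpoint z w ℤ.+ a ℤ.≤ path (ℤ.- z) (map not (w ++ v)) i →
      path z (w ++ v) i ℤ.≤ endpoint z w ℤ.- a
    flip≤ a le = ℤ.neg-cancel-≤ (subst₂ ℤ._≤_ (sym (double-neg (endpoint z w) a)) (path-flip z (w ++ v) i) le)

-- Staircase paths of index pairs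

-- A finite schedule of moves, recorded as the lattice path of the two tokens' indices. In this form
-- its existence up to a given pair is decidable.
data Reach (Ok : ℕ → ℕ → Set) : ℕ → ℕ → Set where
  start : Ok 0 0 → Reach Ok 0 0
  right : ∀ {i j} → Reach Ok i j → Ok (suc i) j → Reach Ok (suc i) j
  up    : ∀ {i j} → Reach Ok i j → Ok i (suc j) → Reach Ok i (suc j)

module _ {Ok : ℕ → ℕ → Set} where

  reach-ok : ∀ {i j} → Reach Ok i j → Ok i j
  reach-ok (start ok)   = ok
  reach-ok (right _ ok) = ok
  reach-ok (up _ ok)    = ok

  -- Indices grow one at a time, so no earlier column is skipped.
  reach-column : ∀ {i j i′} → Reach Ok i j → i′ ≤ i → ∃ λ j′ → j′ ≤ j × Reach Ok i′ j′
  reach-column p@(start _) z≤n = _ , ≤-refl , p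
  reach-column (up p _) i′≤i with j′ , j′≤j , q ← reach-column p i′≤i = j′ , m≤n⇒m≤1+n j′≤j , q
  reach-column p@(right q _) i′≤i with m≤n⇒m<n∨m≡n i′≤i
  ... | inj₁ i′<i = reach-column q (s≤s⁻¹ i′<i)
  ... | inj₂ refl = _ , ≤-refl , p

  reach-row : ∀ {i j j′} → Reach Ok i j → j′ ≤ j → ∃ λ i′ → i′ ≤ i × Reach Ok i′ j′
  reach-row p@(start _) z≤n = _ , ≤-refl , p
  reach-row (right p _) j′≤j with i′ , i′≤i , q ← reach-row p j′≤j = i′ , m≤n⇒m≤1+n i′≤i , q
  reach-row p@(up q _) j′≤j with m≤n⇒m<n∨m≡n j′≤j
  ... | inj₁ j′<j = reach-row q (s≤s⁻¹ j′<j)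
  ... | inj₂ refl = _ , ≤-refl , p

  reach? : (∀ i j → Dec (Ok i j)) → ∀ i j → Dec (Reach Ok i j)
  reach? ok? zero zero = map′ start reach-ok (ok? 0 0)
  reach? ok? (suc i) zero = map′ (λ (p , ok) → right p ok) (λ { (right p ok) → p , ok })
    (reach? ok? i zero ×-dec ok? (suc i) zero)
  reach? ok? zero (suc j) = map′ (λ (p , ok) → up p ok) (λ { (up p ok) → p , ok })
    (reach? ok? zero j ×-dec ok? zero (suc j))
  reach? ok? (suc i) (suc j) =
    map′ (λ { (inj₁ p , ok) → right p ok ; (inj₂ p , ok) → up p ok })
         (λ { (right p ok) → inj₁ p , ok ; (up p ok) → inj₂ p , ok })
      ((reach? ok? i (suc j) ⊎-dec reach? ok? (suc i) j) ×-dec ok? (suc i) (suc j))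

-- The restriction to `k ≤ i` allows exchanging walks of the first token that agree only up to index
-- `i`.
reach-cong : ∀ {Ok Ok′ : ℕ → ℕ → Set} {i j} → (∀ k l → k ≤ i → Ok k l → Ok′ k l) →
  Reach Ok i j → Reach Ok′ i j
reach-cong f (start ok)   = start (f _ _ ≤-refl ok)
reach-cong f (right p ok) = right (reach-cong (λ k l k≤i → f k l (m≤n⇒m≤1+n k≤i)) p) (f _ _ ≤-refl ok)
reach-cong f (up p ok)    = up (reach-cong f p) (f _ _ ≤-refl ok)

-- The pursuit of a fixed walk in ℤ

module Chase (n : ℕ) (s : ℕ → ℤ) where

  Gap : ℤ → ℤ → Set
  Gap x y = y ℤ.< x × x ℤ.< y ℤ.+ + n

  Apart : (ℕ → ℤ) → ℕ → ℕ → Set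
  Apart r i j = Gap (r i) (s j)

  apart? : ∀ r i j → Dec (Apart r i j)
  apart? r i j = (s j ℤ.<? r i) ×-dec (r i ℤ.<? (s j ℤ.+ + n))

  reachable : ℤ → Vec Bool L → ℕ → Bool
  reachable {L} z bs j = does (reach? (apart? (path z bs)) L j)

  -- The second token may need arbitrarily many steps to let the first one finish. The bound `T` on
  -- its index makes survival a Boolean that consults only the first `T` positions of `s`; larger
  -- `T` only add survivors.
  alive : ℕ → ℤ → Vec Bool L → Bool
  alive zero    z bs = false
  alive (suc T) z bs = alive T z bs ∨ reachable z bs T

  alive-sound : ∀ T z (bs : Vec Bool L) → alive T z bs ≡ true →
    ∃ λ j → j < T × Reach (Apart (path z bs)) L j
  alive-sound {L} (suc T) z bs eq with alive T z bs in old | reach? (apart? (path z bs)) L T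
  ... | true  | _     with j , j<T , p ← alive-sound T z bs old = j , m≤n⇒m≤1+n j<T , p
  ... | false | yes p = T , ≤-refl , p

  alive-complete : ∀ T z (bs : Vec Bool L) {j} → j < T → Reach (Apart (path z bs)) L j →
    alive T z bs ≡ true
  alive-complete {L} (suc T) z bs j<T p with m≤n⇒m<n∨m≡n j<T
  ... | inj₁ j<T′ rewrite alive-complete T z bs (s≤s⁻¹ j<T′) p = refl
  ... | inj₂ refl with alive T z bs
  ...   | true  = refl
  ...   | false = dec-true (reach? (apart? (path z bs)) L T) p

  -- A staircase to column `t + m` crosses column `t` in a row that is no higher, so the same bound
  -- `T` still holds.
  alive-prefixClosed : ∀ T z → PrefixClosed (alive T z)
  alive-prefixClosed T z {t} {m} w v eq
    with j , j<T , p ← alive-sound T z (w ++ v) eq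
    with j′ , j′≤j , q ← reach-column p (m≤m+n t m)
    = alive-complete T z w (≤-<-trans j′≤j j<T)
        (reach-cong (λ k l k≤t → subst (λ x → Gap x (s l)) (path-++ z w v k k≤t)) q)

  -- Whichever of the two extrema is reached first, the second token has by then gone too far
  -- in its direction for the other walk.
  alive-oneSided : ∀ T z → OneSided n (alive T z)
  alive-oneSided T z {t} {m} w v v′ hit hit′ eq eq′
    with _ , _ , p ← alive-sound T z (w ++ v) eq
    with _ , _ , p′ ← alive-sound T z (w ++ v′) eq′
    with i , i≤ , top , low ← block-rise n t w v z hit
    with i′ , i′≤ , bottom , high ← block-fall n t w v′ z hit′
    with j , _ , q ← reach-column p i≤
    with j′ , _ , q′ ← reach-column p′ i′≤
    with ≤-total j j′
  -- The rise forces `s j` above `e + fall + 1`, but the falling walk passes row `j` at a column up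
  -- to `i′`, where it is at most `e + fall`.
  ... | inj₁ j≤j′ with k , k≤i′ , o ← reach-row q′ j≤j′ =
    ℤ.<-irrefl refl (begin-strict
      e ℤ.+ + rise n t                ≤⟨ top ⟩
      path z (w ++ v) i               <⟨ proj₂ (reach-ok q) ⟩
      s j ℤ.+ + n                     <⟨ ℤ.+-monoˡ-< (+ n) (proj₁ (reach-ok o)) ⟩
      path z (w ++ v′) k ℤ.+ + n      ≤⟨ ℤ.+-monoˡ-≤ (+ n) (high k k≤i′) ⟩
      e ℤ.+ + fall n t ℤ.+ + n        ≤⟨ ℤ.i≤suc[i] _ ⟩
      ℤ.suc (e ℤ.+ + fall n t ℤ.+ + n) ≡⟨ regroup e (+ fall n t) (+ n) ⟩
      e ℤ.+ + rise n t                ∎)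
    where
    open ℤ.≤-Reasoning
    e = endpoint z w
    regroup : ∀ e f n → 1ℤ ℤ.+ (e ℤ.+ f ℤ.+ n) ≡ e ℤ.+ ((1ℤ ℤ.+ f) ℤ.+ n)
    regroup = ℤ.solve-∀
  -- Dually, the fall forces `s j′` below `e - rise`, but the rising walk passes row `j′` while
  -- still at or above `e - fall`, which is too far away.
  ... | inj₂ j′≤j with k , k≤i , o ← reach-row q j′≤j =
    ℤ.<-irrefl refl (begin-strict
      e ℤ.- + fall n t                ≤⟨ low k k≤i ⟩
      path z (w ++ v) k               <⟨ proj₂ (reach-ok o) ⟩
      s j′ ℤ.+ + n                    <⟨ ℤ.+-monoˡ-< (+ n) (proj₁ (reach-ok q′)) ⟩
      path z (w ++ v′) i′ ℤ.+ + n     ≤⟨ ℤ.+-monoˡ-≤ (+ n) bottom ⟩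
      e ℤ.- + rise n t ℤ.+ + n        ≤⟨ ℤ.i≤suc[i] _ ⟩
      ℤ.suc (e ℤ.- + rise n t ℤ.+ + n) ≡⟨ regroup e (+ fall n t) (+ n) ⟩
      e ℤ.- + fall n t                ∎)
    where
    open ℤ.≤-Reasoning
    e = endpoint z w
    regroup : ∀ e f n → 1ℤ ℤ.+ (e ℤ.- ((1ℤ ℤ.+ f) ℤ.+ n) ℤ.+ n) ≡ e ℤ.- f
    regroup = ℤ.solve-∀

  -- A unit step cannot jump over an end of the gap; it would have to land on it, which the two
  -- inequations exclude.
  gap-moveˡ : ∀ b {x y} → Gap x y → move b x ≢ y → move b x ≢ y ℤ.+ + n → Gap (move b x) y
  gap-moveˡ true {x} (y<x , x<y+n) _ ≢y+n =
    ℤ.<-≤-trans y<x (ℤ.i≤suc[i] x) , ℤ.≤∧≢⇒< (ℤ.i<j⇒suc[i]≤j x<y+n) ≢y+n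
  gap-moveˡ false (y<x , x<y+n) ≢y _ =
    ℤ.≤∧≢⇒< (ℤ.i<j⇒i≤pred[j] y<x) (≢y ∘ sym) , ℤ.≤-<-trans (ℤ.i≤j⇒pred[i]≤j ℤ.≤-refl) x<y+n

  gap-moveʳ : ∀ b {x y} → Gap x y → x ≢ move b y → x ≢ move b y ℤ.+ + n → Gap x (move b y)
  gap-moveʳ true {y = y} (y<x , x<y+n) ≢y _ =
    ℤ.≤∧≢⇒< (ℤ.i<j⇒suc[i]≤j y<x) (≢y ∘ sym) , ℤ.<-≤-trans x<y+n (ℤ.+-monoˡ-≤ (+ n) (ℤ.i≤suc[i] y))
  gap-moveʳ false {y = y} (y<x , x<y+n) _ ≢y+n =
    ℤ.≤-<-trans (ℤ.i≤j⇒pred[i]≤j ℤ.≤-refl) y<x ,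
    ℤ.≤∧≢⇒< (ℤ.≤-trans (ℤ.i<j⇒i≤pred[j] x<y+n) (ℤ.≤-reflexive (sym (ℤ.pred-+ y (+ n))))) ≢y+n

-- Covers by cylinders

-- With the predecessor of the denominator as argument, `½`, `1 / n` and the target `1 / (e + 1)`
-- all have this form by computation.
fraction : ℕ → ℕ → ℚ
fraction a d = + a ℚ./ suc d

fraction-+ : ∀ a b d → fraction a d ℚ.+ fraction b d ≡ fraction (a + b) d
fraction-+ a b d = ℚ.toℚᵘ-injective (begin
  ℚ.toℚᵘ (fraction a d ℚ.+ fraction b d)                ≈⟨ ℚ.toℚᵘ-homo-+ (fraction a d) (fraction b d) ⟩
  ℚ.toℚᵘ (fraction a d) ℚᵘ.+ ℚ.toℚᵘ (fraction b d)      ≈⟨ ℚᵘ.+-cong (ℚ.toℚᵘ-fromℚᵘ (mkℚᵘ (+ a) d)) (ℚ.toℚᵘ-fromℚᵘ (mkℚᵘ (+ b) d)) ⟩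
  mkℚᵘ (+ a) d ℚᵘ.+ mkℚᵘ (+ b) d                        ≈⟨ *≡* (regroup (+ a) (+ b) (+ suc d)) ⟩
  mkℚᵘ (+ (a + b)) d                                    ≈⟨ ℚ.toℚᵘ-fromℚᵘ (mkℚᵘ (+ (a + b)) d) ⟨
  ℚ.toℚᵘ (fraction (a + b) d)                           ∎)
  where
  open ℚᵘ.≃-Reasoning
  regroup : ∀ a b d → (a ℤ.* d ℤ.+ b ℤ.* d) ℤ.* d ≡ (a ℤ.+ b) ℤ.* (d ℤ.* d)
  regroup = ℤ.solve-∀

fraction-* : ∀ c d → fraction 1 c ℚ.* fraction 1 d ≡ fraction 1 (d + c * suc d)
fraction-* c d = ℚ.toℚᵘ-injective (begin
  ℚ.toℚᵘ (fraction 1 c ℚ.* fraction 1 d)                ≈⟨ ℚ.toℚᵘ-homo-* (fraction 1 c) (fraction 1 d) ⟩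
  ℚ.toℚᵘ (fraction 1 c) ℚᵘ.* ℚ.toℚᵘ (fraction 1 d)      ≈⟨ ℚᵘ.*-cong (ℚ.toℚᵘ-fromℚᵘ (mkℚᵘ (+ 1) c)) (ℚ.toℚᵘ-fromℚᵘ (mkℚᵘ (+ 1) d)) ⟩
  mkℚᵘ (+ 1) c ℚᵘ.* mkℚᵘ (+ 1) d                        ≈⟨ *≡* refl ⟩
  mkℚᵘ (+ 1) (d + c * suc d)                            ≈⟨ ℚ.toℚᵘ-fromℚᵘ (mkℚᵘ (+ 1) (d + c * suc d)) ⟨
  ℚ.toℚᵘ (fraction 1 (d + c * suc d))                   ∎)
  where open ℚᵘ.≃-Reasoning

fraction-≤ : ∀ {a b c d} → a * suc d ≤ b * suc c → fraction a c ℚ.≤ fraction b d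
fraction-≤ {a} {b} {c} {d} le = ℚ.toℚᵘ-cancel-≤ (begin
  ℚ.toℚᵘ (fraction a c)   ≃⟨ ℚ.toℚᵘ-fromℚᵘ (mkℚᵘ (+ a) c) ⟩
  mkℚᵘ (+ a) c            ≤⟨ *≤* (subst₂ ℤ._≤_ (ℤ.pos-* a (suc d)) (ℤ.pos-* b (suc c)) (ℤ.+≤+ le)) ⟩
  mkℚᵘ (+ b) d            ≃⟨ ℚ.toℚᵘ-fromℚᵘ (mkℚᵘ (+ b) d) ⟨
  ℚ.toℚᵘ (fraction b d)   ∎)
  where open ℚᵘ.≤-Reasoning

sumUpTo : (ℕ → ℕ) → ℕ → ℕ
sumUpTo f zero    = 0
sumUpTo f (suc N) = sumUpTo f N + f N

sumUpTo-suc : ∀ f N → sumUpTo f (suc N) ≡ f 0 + sumUpTo (f ∘ suc) N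
sumUpTo-suc f zero    = sym (+-identityʳ (f 0))
sumUpTo-suc f (suc N) = trans (cong (_+ f (suc N)) (sumUpTo-suc f N)) (+-assoc (f 0) _ _)

-- The concatenation of xs, st 0, st 1, …, with a blank after each list so that empty lists do no harm.
emit : List A → (ℕ → List A) → ℕ → Maybe A
emit []       st zero    = nothing
emit []       st (suc i) = emit (st 0) (st ∘ suc) i
emit (x ∷ xs) st zero    = just x
emit (x ∷ xs) st (suc i) = emit xs st i

emit-head : ∀ {x : A} {xs} st → x ∈ xs → ∃ λ i → emit xs st i ≡ just x
emit-head st (here refl) = 0 , refl
emit-head st (there p) with i , eq ← emit-head st p = suc i , eq

emit-skip : ∀ {y : Maybe A} xs st → (∃ λ i → emit (st 0) (st ∘ suc) i ≡ y) → ∃ λ i → emit xs st i ≡ y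
emit-skip []       st (i , eq) = suc i , eq
emit-skip (x ∷ xs) st found with i , eq ← emit-skip xs st found = suc i , eq

emit-stage : ∀ {x : A} T xs st → x ∈ st T → ∃ λ i → emit xs st i ≡ just x
emit-stage zero    xs st p = emit-skip xs st (emit-head (st ∘ suc) p)
emit-stage (suc T) xs st p = emit-skip xs st (emit-stage T (st 0) (st ∘ suc) p)

weight : Maybe A → ℕ
weight = maybe′ (λ _ → 1) 0

-- Passing to the next list uses up a blank, so the first `N` entries come from `xs` and the first
-- `N` stages only.
weight-emit : ∀ (xs : List A) st N →
  sumUpTo (weight ∘ emit xs st) N ≤ length xs + sumUpTo (length ∘ st) N
weight-emit xs st zero = z≤n
weight-emit [] st (suc N) = begin
  sumUpTo (weight ∘ emit [] st) (suc N)                     ≡⟨ sumUpTo-suc (weight ∘ emit [] st) N ⟩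
  sumUpTo (weight ∘ emit (st 0) (st ∘ suc)) N               ≤⟨ weight-emit (st 0) (st ∘ suc) N ⟩
  length (st 0) + sumUpTo (length ∘ st ∘ suc) N             ≡⟨ sumUpTo-suc (length ∘ st) N ⟨
  sumUpTo (length ∘ st) (suc N)                             ∎
  where open ≤-Reasoning
weight-emit (x ∷ xs) st (suc N) = begin
  sumUpTo (weight ∘ emit (x ∷ xs) st) (suc N)               ≡⟨ sumUpTo-suc (weight ∘ emit (x ∷ xs) st) N ⟩
  suc (sumUpTo (weight ∘ emit xs st) N)                     ≤⟨ s≤s (weight-emit xs st N) ⟩
  suc (length xs + sumUpTo (length ∘ st) N)                 ≤⟨ +-monoʳ-≤ (suc (length xs)) (m≤m+n _ _) ⟩
  suc (length xs) + sumUpTo (length ∘ st) (suc N)           ∎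
  where open ≤-Reasoning

-- Tallies over lists of step sequences

tally : (A → Bool) → List A → ℕ
tally P xs = length (filterᵇ P xs)

tally-∷ : ∀ (P : A → Bool) x xs → tally P (x ∷ xs) ≡ indicator (P x) + tally P xs
tally-∷ P x xs with P x
... | true  = refl
... | false = refl

tally-++ : ∀ (P : A → Bool) xs ys → tally P (xs List.++ ys) ≡ tally P xs + tally P ys
tally-++ P [] ys = refl
tally-++ P (x ∷ xs) ys = begin
  tally P (x ∷ xs List.++ ys)                    ≡⟨ tally-∷ P x (xs List.++ ys) ⟩
  indicator (P x) + tally P (xs List.++ ys)      ≡⟨ cong (λ k → indicator (P x) + k) (tally-++ P xs ys) ⟩
  indicator (P x) + (tally P xs + tally P ys)    ≡⟨ +-assoc (indicator (P x)) _ _ ⟨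
  indicator (P x) + tally P xs + tally P ys      ≡⟨ cong (_+ tally P ys) (tally-∷ P x xs) ⟨
  tally P (x ∷ xs) + tally P ys                  ∎
  where open ≡-Reasoning

tally-map : ∀ {B : Set} (P : B → Bool) (f : A → B) xs → tally P (List.map f xs) ≡ tally (P ∘ f) xs
tally-map P f [] = refl
tally-map P f (x ∷ xs) with P (f x)
... | true  = cong suc (tally-map P f xs)
... | false = tally-map P f xs

-- One step of the telescoping in `sum-stages`: `P` holds what is already listed, `Q` what the
-- current stage finds.
tally-new : ∀ (P Q : A → Bool) xs →
  tally P xs + tally (λ x → Q x ∧ not (P x)) xs ≡ tally (λ x → P x ∨ Q x) xs
tally-new P Q [] = refl
tally-new P Q (x ∷ xs) with P x | Q x
... | true  | true  = cong suc (tally-new P Q xs)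
... | true  | false = cong suc (tally-new P Q xs)
... | false | true  = trans (+-suc (tally P xs) _) (cong suc (tally-new P Q xs))
... | false | false = tally-new P Q xs

tally-none : ∀ (xs : List A) → tally (λ _ → false) xs ≡ 0
tally-none []       = refl
tally-none (_ ∷ xs) = tally-none xs

tally-product : ∀ {B : Set} (P : A × B → Bool) xs ys K M →
  (∀ x → tally (λ y → P (x , y)) ys * K ≤ M) → tally P (cartesianProduct xs ys) * K ≤ length xs * M
tally-product P []       ys K M bound = z≤n
tally-product P (x ∷ xs) ys K M bound = begin
  tally P (List.map (x ,_) ys List.++ rest) * K             ≡⟨ cong (_* K) (tally-++ P (List.map (x ,_) ys) rest) ⟩
  (tally P (List.map (x ,_) ys) + tally P rest) * K         ≡⟨ cong (λ c → (c + tally P rest) * K) (tally-map P (x ,_) ys) ⟩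
  (tally (λ y → P (x , y)) ys + tally P rest) * K           ≡⟨ *-distribʳ-+ K (tally (λ y → P (x , y)) ys) _ ⟩
  tally (λ y → P (x , y)) ys * K + tally P rest * K         ≤⟨ +-mono-≤ (bound x) (tally-product P xs ys K M bound) ⟩
  length (x ∷ xs) * M                                       ∎
  where
  open ≤-Reasoning
  rest = cartesianProduct xs ys

allSteps : ∀ L → List (Vec Bool L)
allSteps zero    = [] ∷ []
allSteps (suc L) = List.map (true ∷_) (allSteps L) List.++ List.map (false ∷_) (allSteps L)

∈-allSteps : (bs : Vec Bool L) → bs ∈ allSteps L
∈-allSteps [] = here refl
∈-allSteps (true ∷ bs)  = ∈-++⁺ˡ (∈-map⁺ (true ∷_) (∈-allSteps bs))
∈-allSteps (false ∷ bs) = ∈-++⁺ʳ (List.map (true ∷_) (allSteps _)) (∈-map⁺ (false ∷_) (∈-allSteps bs))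

tally-allSteps : (P : Vec Bool L → Bool) → tally P (allSteps L) ≡ count P
tally-allSteps {zero} P = trans (tally-∷ P [] []) (+-identityʳ _)
tally-allSteps {suc L} P = begin
  tally P (allSteps (suc L))      ≡⟨ tally-++ P (List.map (true ∷_) (allSteps L)) _ ⟩
  tally P (List.map (true ∷_) (allSteps L)) + tally P (List.map (false ∷_) (allSteps L))
    ≡⟨ cong₂ _+_ (tally-map P (true ∷_) (allSteps L)) (tally-map P (false ∷_) (allSteps L)) ⟩
  tally (P ∘ (true ∷_)) (allSteps L) + tally (P ∘ (false ∷_)) (allSteps L)
    ≡⟨ cong₂ _+_ (tally-allSteps (P ∘ (true ∷_))) (tally-allSteps (P ∘ (false ∷_))) ⟩
  count P                         ∎
  where open ≡-Reasoning

-- Lifting walks on the cycle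

steps : (ℕ → Bool) → ∀ L → Vec Bool L
steps d zero    = []
steps d (suc L) = d 0 ∷ steps (d ∘ suc) L

lift : ℤ → (ℕ → Bool) → ℕ → ℤ
lift z d zero    = z
lift z d (suc i) = move (d i) (lift z d i)

-- `lift` applies the latest step last, whereas `path` consumes the first step first; this
-- reconciles the two recursions.
lift-suc : ∀ z d i → lift z d (suc i) ≡ lift (move (d 0) z) (d ∘ suc) i
lift-suc z d zero    = refl
lift-suc z d (suc i) = cong (move (d (suc i))) (lift-suc z d i)

path-steps : ∀ z d L i → i ≤ L → path z (steps d L) i ≡ lift z d i
path-steps z d L       zero    _   = path-zero (steps d L)
  where
  path-zero : ∀ {L} (bs : Vec Bool L) → path z bs 0 ≡ z
  path-zero []      = refl
  path-zero (_ ∷ _) = refl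
path-steps z d (suc L) (suc i) i≤L =
  trans (path-steps (move (d 0) z) (d ∘ suc) L i (s≤s⁻¹ i≤L)) (sym (lift-suc z d i))

module _ (k : ℕ) where

  private
    n : ℕ
    n = 3 + k

  open Cycle n

  Lifts : ℤ → Fin n → Set
  Lifts z x = ∃ λ q → z ≡ + toℕ x ℤ.+ q ℤ.* + n

  lifts-toℕ : ∀ x → Lifts (+ toℕ x) x
  lifts-toℕ x = 0ℤ , sym (ℤ.+-identityʳ (+ toℕ x))

  lifts-+n : ∀ {z x} → Lifts z x → Lifts (z ℤ.+ + n) x
  lifts-+n {x = x} (q , refl) = ℤ.suc q , regroup (+ toℕ x) q (+ n)
    where
    regroup : ∀ a q n → a ℤ.+ q ℤ.* n ℤ.+ n ≡ a ℤ.+ (1ℤ ℤ.+ q) ℤ.* n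
    regroup = ℤ.solve-∀

  suc-% : ∀ a → ℤ.suc (+ a) ≡ + (suc a % n) ℤ.+ + (suc a / n) ℤ.* + n
  suc-% a = trans (cong +_ (m≡m%n+[m/n]*n (suc a) n))
    (cong (λ p → + (suc a % n) ℤ.+ p) (ℤ.pos-* (suc a / n) n))

  lifts-suc : ∀ {z x y} → toℕ y ≡ suc (toℕ x) % n → Lifts z x → Lifts (ℤ.suc z) y
  lifts-suc {x = x} {y} eq (q , refl) = q ℤ.+ c , (begin
    1ℤ ℤ.+ (+ toℕ x ℤ.+ q ℤ.* + n)              ≡⟨ ℤ.+-assoc 1ℤ (+ toℕ x) (q ℤ.* + n) ⟨
    1ℤ ℤ.+ + toℕ x ℤ.+ q ℤ.* + n                ≡⟨ cong (ℤ._+ q ℤ.* + n) (suc-% (toℕ x)) ⟩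
    + (suc (toℕ x) % n) ℤ.+ c ℤ.* + n ℤ.+ q ℤ.* + n ≡⟨ cong (λ a → + a ℤ.+ c ℤ.* + n ℤ.+ q ℤ.* + n) eq ⟨
    + toℕ y ℤ.+ c ℤ.* + n ℤ.+ q ℤ.* + n         ≡⟨ regroup (+ toℕ y) c q (+ n) ⟩
    + toℕ y ℤ.+ (q ℤ.+ c) ℤ.* + n               ∎)
    where
    open ≡-Reasoning
    c = + (suc (toℕ x) / n)
    regroup : ∀ a c q n → a ℤ.+ c ℤ.* n ℤ.+ q ℤ.* n ≡ a ℤ.+ (q ℤ.+ c) ℤ.* n
    regroup = ℤ.solve-∀

  lifts-pred : ∀ {z x y} → toℕ x ≡ suc (toℕ y) % n → Lifts z x → Lifts (ℤ.pred z) y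
  lifts-pred {x = x} {y} eq (q , refl) = q ℤ.- c , (begin
    -1ℤ ℤ.+ (+ toℕ x ℤ.+ q ℤ.* + n)             ≡⟨ cong (λ a → -1ℤ ℤ.+ (+ a ℤ.+ q ℤ.* + n)) eq ⟩
    -1ℤ ℤ.+ (+ (suc (toℕ y) % n) ℤ.+ q ℤ.* + n) ≡⟨ regroup (+ (suc (toℕ y) % n)) c q (+ n) ⟩
    -1ℤ ℤ.+ (+ (suc (toℕ y) % n) ℤ.+ c ℤ.* + n) ℤ.+ (q ℤ.- c) ℤ.* + n
      ≡⟨ cong (λ a → -1ℤ ℤ.+ a ℤ.+ (q ℤ.- c) ℤ.* + n) (suc-% (toℕ y)) ⟨
    -1ℤ ℤ.+ ℤ.suc (+ toℕ y) ℤ.+ (q ℤ.- c) ℤ.* + n ≡⟨ cong (ℤ._+ (q ℤ.- c) ℤ.* + n) (ℤ.pred-suc (+ toℕ y)) ⟩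
    + toℕ y ℤ.+ (q ℤ.- c) ℤ.* + n               ∎)
    where
    open ≡-Reasoning
    c = + (suc (toℕ y) / n)
    regroup : ∀ a c q n → -1ℤ ℤ.+ (a ℤ.+ q ℤ.* n) ≡ -1ℤ ℤ.+ (a ℤ.+ c ℤ.* n) ℤ.+ (q ℤ.- c) ℤ.* n
    regroup = ℤ.solve-∀

  -- The difference of the two residues is a multiple of `n` and smaller than `n` in absolute value,
  -- so it vanishes.
  lifts-unique : ∀ {z x y} → Lifts z x → Lifts z y → x ≡ y
  lifts-unique {x = x} {y} (q , refl) (q′ , eq) = toℕ-injective (ℤ.+-injective (ℤ.i-j≡0⇒i≡j (+ a) (+ b)
    (ℤ.∣i∣≡0⇒i≡0 (small ∣ + a ℤ.- + b ∣ refl))))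
    where
    a = toℕ x
    b = toℕ y
    difference : + a ℤ.- + b ≡ (q′ ℤ.- q) ℤ.* + n
    difference = begin
      + a ℤ.- + b                                               ≡⟨ expand (+ a) (+ b) q (+ n) ⟩
      (+ a ℤ.+ q ℤ.* + n) ℤ.- + b ℤ.- q ℤ.* + n                 ≡⟨ cong (λ e → e ℤ.- + b ℤ.- q ℤ.* + n) eq ⟩
      (+ b ℤ.+ q′ ℤ.* + n) ℤ.- + b ℤ.- q ℤ.* + n                ≡⟨ collect (+ b) q q′ (+ n) ⟩
      (q′ ℤ.- q) ℤ.* + n                                        ∎
      where
      open ≡-Reasoning
      expand : ∀ a b q n → a ℤ.- b ≡ (a ℤ.+ q ℤ.* n) ℤ.- b ℤ.- q ℤ.* n
      expand = ℤ.solve-∀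
      collect : ∀ b q q′ n → (b ℤ.+ q′ ℤ.* n) ℤ.- b ℤ.- q ℤ.* n ≡ (q′ ℤ.- q) ℤ.* n
      collect = ℤ.solve-∀
    small : ∀ d → ∣ + a ℤ.- + b ∣ ≡ d → d ≡ 0
    small zero    _  = refl
    small (suc d) d≡ = contradiction (begin
      n                     ≤⟨ ∣⇒≤ (divides ∣ q′ ℤ.- q ∣ (trans (sym d≡) (trans (cong ∣_∣ difference) (ℤ.abs-* (q′ ℤ.- q) (+ n))))) ⟩
      suc d                 ≡⟨ d≡ ⟨
      ∣ + a ℤ.- + b ∣       ≡⟨ cong ∣_∣ (ℤ.[+m]-[+n]≡m⊖n a b) ⟩
      ∣ a ℤ.⊖ b ∣           ≤⟨ ℤ.∣m⊝n∣≤m⊔n a b ⟩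
      a ⊔ b        ∎) (<⇒≱ (⊔-lub (toℕ<n x) (toℕ<n y)))
      where open ≤-Reasoning

  turn : Bool → Fin n → Fin n
  turn true  x           = fromℕ< (m%n<n (suc (toℕ x)) n)
  turn false Fin.zero    = fromℕ (2 + k)
  turn false (Fin.suc x) = inject₁ x

  direction : ∀ {x y} → Adj x y → Bool
  direction (inj₁ _) = true
  direction (inj₂ _) = false

  turn-direction : ∀ {x y} (a : Adj x y) → turn (direction a) x ≡ y
  turn-direction (inj₁ eq) = toℕ-injective (trans (toℕ-fromℕ< _) (sym eq))
  -- The remainder modulo `n` wraps around exactly when `y` is the last vertex.
  turn-direction {x} {y} (inj₂ eq) with m≤n⇒m<n∨m≡n (toℕ<n y)
  turn-direction {Fin.zero}  (inj₂ eq) | inj₁ y<n = case trans eq (m<n⇒m%n≡m y<n) of λ ()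
  turn-direction {Fin.suc x} (inj₂ eq) | inj₁ y<n = toℕ-injective
    (trans (toℕ-inject₁ x) (suc-injective (trans eq (m<n⇒m%n≡m y<n))))
  turn-direction {Fin.zero}  (inj₂ eq) | inj₂ y≡n = toℕ-injective
    (trans (toℕ-fromℕ (2 + k)) (sym (suc-injective y≡n)))
  turn-direction {Fin.suc x} {y} (inj₂ eq) | inj₂ y≡n =
    case trans eq (trans (cong (_% n) y≡n) (n%n≡0 n)) of λ ()

  lifts-move : ∀ {z x y} (a : Adj x y) → Lifts z x → Lifts (move (direction a) z) y
  lifts-move (inj₁ eq) = lifts-suc eq
  lifts-move (inj₂ eq) = lifts-pred eq

  module _ {R : ℕ → Fin n} (walk : IsWalk R) where

    directions : ℕ → Bool
    directions i = direction (walk i)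

    lifts-walk : ∀ {z} → Lifts z (R 0) → ∀ i → Lifts (lift z directions i) (R i)
    lifts-walk l zero    = l
    lifts-walk l (suc i) = lifts-move (walk i) (lifts-walk l i)

  trail : Fin n → Vec Bool L → List (Fin n)
  trail x []       = []
  trail x (b ∷ bs) = turn b x ∷ trail (turn b x) bs

  extends-trail : ∀ {R} (walk : IsWalk R) L → Extends R (R 0 ∷ trail (R 0) (steps (directions walk) L))
  extends-trail walk zero    = refl , tt
  extends-trail {R} walk (suc L) rewrite turn-direction (walk 0) = refl , extends-trail (walk ∘ suc) L

  -- Each factor is `½` or `0ℚ`, so at most `½`; a cover asks only for an upper bound.
  stepMass-≤ : ∀ x (bs : Vec Bool L) → stepMass x (trail x bs) ℚ.≤ fraction 1 (pred-2^ L)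
  stepMass-≤ x [] = ℚ.≤-refl
  stepMass-≤ {suc L} x (b ∷ bs) = begin
    (if adj? x y then ½ else 0ℚ) ℚ.* stepMass y (trail y bs)   ≤⟨ factor (adj? x y) ⟩
    ½ ℚ.* fraction 1 (pred-2^ L)                              ≡⟨ fraction-* 1 (pred-2^ L) ⟩
    fraction 1 (pred-2^ (suc L))                              ∎
    where
    open ℚ.≤-Reasoning
    y = turn b x
    factor : ∀ c → (if c then ½ else 0ℚ) ℚ.* stepMass y (trail y bs) ℚ.≤ ½ ℚ.* fraction 1 (pred-2^ L)
    factor true  = ℚ.*-monoˡ-≤-nonNeg ½ (stepMass-≤ y bs)
    factor false = begin
      0ℚ ℚ.* stepMass y (trail y bs)   ≡⟨ ℚ.*-zeroˡ (stepMass y (trail y bs)) ⟩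
      0ℚ                               ≤⟨ fraction-≤ {0} {1} {0} {pred-2^ (suc L)} z≤n ⟩
      fraction 1 (pred-2^ (suc L))     ≡⟨ fraction-* 1 (pred-2^ L) ⟨
      ½ ℚ.* fraction 1 (pred-2^ L)     ∎

  module _ (L : ℕ) where

    -- `n * 2 ^ L - 1`, the shape in which `fraction-*` returns the product of `1 / n` and
    -- `1 / 2 ^ L`.
    pred-total : ℕ
    pred-total = pred-2^ L + (2 + k) * suc (pred-2^ L)

    render : Maybe (Fin n × Vec Bool L) → List (Fin n)
    -- A blank must still be a cylinder. A vertex of the cycle is not adjacent to itself, so this
    -- one has mass 0.
    render nothing         = Fin.zero ∷ Fin.zero ∷ []
    render (just (x , bs)) = x ∷ trail x bs

    mass-≤ : ∀ w → mass (render w) ℚ.≤ fraction (weight w) pred-total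
    mass-≤ nothing = begin
      fraction 1 (2 + k) ℚ.* (0ℚ ℚ.* 1ℚ)   ≡⟨ ℚ.*-zeroʳ (fraction 1 (2 + k)) ⟩
      0ℚ                                   ≤⟨ fraction-≤ {0} {0} {0} {pred-total} z≤n ⟩
      fraction 0 pred-total                ∎
      where open ℚ.≤-Reasoning
    mass-≤ (just (x , bs)) = begin
      fraction 1 (2 + k) ℚ.* stepMass x (trail x bs)      ≤⟨ ℚ.*-monoˡ-≤-nonNeg (fraction 1 (2 + k)) {{ℚ.normalize-nonNeg 1 n}} (stepMass-≤ x bs) ⟩
      fraction 1 (2 + k) ℚ.* fraction 1 (pred-2^ L)       ≡⟨ fraction-* (2 + k) (pred-2^ L) ⟩
      fraction 1 pred-total                               ∎
      where open ℚ.≤-Reasoning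

    partialSum-≤ : ∀ f N → partialSum (mass ∘ render ∘ f) N ℚ.≤ fraction (sumUpTo (weight ∘ f) N) pred-total
    partialSum-≤ f zero    = fraction-≤ {0} {0} {0} {pred-total} z≤n
    partialSum-≤ f (suc N) = begin
      partialSum (mass ∘ render ∘ f) N ℚ.+ mass (render (f N))   ≤⟨ ℚ.+-mono-≤ (partialSum-≤ f N) (mass-≤ (f N)) ⟩
      fraction (sumUpTo (weight ∘ f) N) pred-total ℚ.+ fraction (weight (f N)) pred-total
        ≡⟨ fraction-+ (sumUpTo (weight ∘ f) N) (weight (f N)) pred-total ⟩
      fraction (sumUpTo (weight ∘ f) (suc N)) pred-total         ∎
      where open ℚ.≤-Reasoning

  countT-mono : ∀ m {t u} → t ≤ u → countT m t ≤ countT m u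
  countT-mono m {t} {u} t≤u with m≤n⇒m<n∨m≡n t≤u
  ... | inj₂ refl = ≤-refl
  countT-mono m {t} {suc u} _ | inj₁ t<u with m u
  ... | true  = m≤n⇒m≤1+n (countT-mono m (s≤s⁻¹ t<u))
  ... | false = countT-mono m (s≤s⁻¹ t<u)

  countT-unbounded : ∀ m → InfOften m true → ∀ L → ∃ λ t → L ≤ countT m t
  countT-unbounded m inf zero = 0 , z≤n
  countT-unbounded m inf (suc L) with t , L≤ ← countT-unbounded m inf L with u , t≤u , mu ← inf t =
    suc u , advance
    where
    advance : suc L ≤ countT m (suc u)
    advance rewrite mu = s≤s (≤-trans L≤ (countT-mono m t≤u))

  -- The null cover of the successful walks

  module _ (S : ℕ → Fin n) (walkS : IsWalk S) where

    s : ℕ → ℤ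
    s = lift (+ toℕ (S 0)) (directions walkS)

    open Chase n s

    -- The lift of `x` in the period that starts at `S 0`, so that every `x` other than `S 0` begins
    -- inside the gap.
    initial : Fin n → ℤ
    initial x = if toℕ (S 0) ≤ᵇ toℕ x then + toℕ x else + toℕ x ℤ.+ + n

    lifts-initial : ∀ x → Lifts (initial x) x
    lifts-initial x with toℕ (S 0) ≤ᵇ toℕ x
    ... | true  = lifts-toℕ x
    ... | false = lifts-+n (lifts-toℕ x)

    gap-initial : ∀ x → x ≢ S 0 → Gap (initial x) (+ toℕ (S 0))
    gap-initial x x≢ with toℕ (S 0) ≤ᵇ toℕ x in eq
    ... | true  = ℤ.+<+ (≤∧≢⇒< (≤ᵇ⇒≤ _ _ (subst T (sym eq) tt)) (x≢ ∘ sym ∘ toℕ-injective)) ,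
                  ℤ.+<+ (<-≤-trans (toℕ<n x) (m≤n+m n _))
    ... | false = ℤ.+<+ (<-≤-trans (toℕ<n (S 0)) (m≤n+m n _)) ,
                  ℤ.+<+ (+-monoˡ-< n (≰⇒> (λ le → subst T eq (≤⇒≤ᵇ le))))

    module _ (R : ℕ → Fin n) (walkR : IsWalk R) where

      r : ℕ → ℤ
      r = lift (initial (R 0)) (directions walkR)

      meet : ∀ i j → r i ≡ s j ⊎ r i ≡ s j ℤ.+ + n → R i ≡ S j
      meet i j (inj₁ eq) = lifts-unique (lifts-walk walkR (lifts-initial (R 0)) i)
        (subst (λ z → Lifts z (S j)) (sym eq) (lifts-walk walkS (lifts-toℕ (S 0)) j))
      meet i j (inj₂ eq) = lifts-unique (lifts-walk walkR (lifts-initial (R 0)) i)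
        (subst (λ z → Lifts z (S j)) (sym eq) (lifts-+n (lifts-walk walkS (lifts-toℕ (S 0)) j)))

      -- By `meet`, landing on an end of the gap would be a collision on the cycle, so a schedule
      -- without collisions never leaves the gap.
      reach-schedule : ∀ m → (∀ t → ¬ R (countT m t) ≡ S (countF m t)) →
        ∀ t → Reach (Apart r) (countT m t) (countF m t)
      reach-schedule m avoid zero = start (gap-initial (R 0) (avoid 0))
      reach-schedule m avoid (suc t) with m t | avoid (suc t) | reach-schedule m avoid t
      ... | true  | apart | p = right p (gap-moveˡ (directions walkR (countT m t)) (reach-ok p)
              (apart ∘ meet _ _ ∘ inj₁) (apart ∘ meet _ _ ∘ inj₂))
      ... | false | apart | p = up p (gap-moveʳ (directions walkS (countF m t)) (reach-ok p)
              (apart ∘ meet _ _ ∘ inj₁) (apart ∘ meet _ _ ∘ inj₂))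

      -- Run the schedule until the first token has made `L` steps; the row in which the staircase
      -- crosses column `L` determines `T`.
      successful-alive : Successful R S → ∀ L →
        ∃ λ T → alive T (initial (R 0)) (steps (directions walkR) L) ≡ true
      successful-alive (m , infT , _ , avoid) L
        with t , L≤ ← countT-unbounded m infT L
        with j , _ , p ← reach-column (reach-schedule m avoid t) L≤
        = suc j , alive-complete (suc j) (initial (R 0)) (steps (directions walkR) L) ≤-refl
            (reach-cong (λ i l i≤L → subst (λ x → Gap x (s l))
              (sym (path-steps (initial (R 0)) (directions walkR) L i i≤L))) p)

    module _ (L : ℕ) where

      candidates : List (Fin n × Vec Bool L)
      candidates = cartesianProduct (allFin n) (allSteps L)

      -- A candidate may be reachable at many indices of `S`; `new` accepts it only at the least
      -- one, so its cylinder is listed in a single stage.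
      survives new : ℕ → Fin n × Vec Bool L → Bool
      survives T (x , bs) = alive T (initial x) bs
      new T w@(x , bs) = reachable (initial x) bs T ∧ not (survives T w)

      stages : ℕ → List (Fin n × Vec Bool L)
      stages T = filterᵇ (new T) candidates

      cover : ℕ → List (Fin n)
      cover = render L ∘ emit [] stages

      first-new : ∀ T w → survives T w ≡ true → ∃ λ U → new U w ≡ true
      first-new (suc T) w@(x , bs) eq with survives T w in old
      ... | true  = first-new T w old
      ... | false = T , trans (cong₂ (λ p q → p ∧ not q) eq old) refl

      -- The sizes telescope, so any finite number of stages is controlled by one survival count,
      -- with a bound uniform in `T`.
      sum-stages : ∀ T → sumUpTo (length ∘ stages) T ≡ tally (survives T) candidates
      sum-stages zero    = sym (tally-none candidates)
      sum-stages (suc T) = trans (cong (_+ tally (new T) candidates) (sum-stages T))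
        (tally-new (survives T) (λ (x , bs) → reachable (initial x) bs T) candidates)

      cover-extends : ∀ R → IsWalk R → Successful R S → ∃ λ i → Extends R (cover i)
      cover-extends R walkR success
        with T , live ← successful-alive R walkR success L
        with U , isNew ← first-new T (R 0 , steps (directions walkR) L) live
        with i , eq ← emit-stage U [] stages (∈-filter⁺ (T? ∘ new U)
               (∈-cartesianProduct⁺ (∈-allFin (R 0)) (∈-allSteps (steps (directions walkR) L)))
               (Equivalence.from T-≡ isNew))
        = i , subst (Extends R ∘ render L) (sym eq) (extends-trail walkR L)

      cover-mass : ∀ e → (∀ T z → count (alive {L} T z) * suc e ≤ 2 ^ L) →
        ∀ N → partialSum (mass ∘ cover) N ℚ.≤ fraction 1 e
      cover-mass e rare N = ℚ.≤-trans (partialSum-≤ L (emit [] stages) N) (fraction-≤ {a = emitted} {1} (begin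
        emitted * suc e                             ≤⟨ *-monoˡ-≤ (suc e) (weight-emit [] stages N) ⟩
        sumUpTo (length ∘ stages) N * suc e         ≡⟨ cong (_* suc e) (sum-stages N) ⟩
        -- For each of the `n` starting vertices at most `2 ^ L / (e + 1)` step sequences survive,
        -- and each cylinder weighs at most `1 / (n * 2 ^ L)`.
        tally (survives N) candidates * suc e       ≤⟨ tally-product (survives N) (allFin n) (allSteps L) (suc e) (2 ^ L)
          (λ x → ≤-trans (≤-reflexive (cong (_* suc e) (tally-allSteps (alive {L} N (initial x))))) (rare N (initial x))) ⟩
        length (allFin n) * 2 ^ L                   ≡⟨ cong₂ _*_ (length-tabulate {n = n} (λ i → i)) (sym (suc-pred-2^ L)) ⟩
        n * suc (pred-2^ L)                         ≡⟨ *-identityˡ (n * suc (pred-2^ L)) ⟨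
        1 * suc (pred-total L)                      ∎))
        where
        open ≤-Reasoning
        emitted = sumUpTo (weight ∘ emit [] stages) N

    successful-null : ProbZero (λ R → Successful R S)
    successful-null e with L , rare ← one-sided-rare n (suc e) =
      cover L , cover-extends L ,
      cover-mass L e (λ T z → rare (alive T z) (alive-prefixClosed T z) (alive-oneSided T z))

theorem3p5 : (k : ℕ) → let open Cycle (suc (suc (suc k))) in
    (S : ℕ → Fin (suc (suc (suc k)))) → IsWalk S → ¬ Evasive S
theorem3p5 k S walk evasive = evasive (successful-null k S walk)
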